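{- Let $G$ be a graph, let $S\subseteq V(G)$ be any subset of vertices, and let $\mathcal{F}$ be any finite family of $S$-stable separations of $G$. Define $$X:=S\cup\bigcup_{(A,B)\in\mathcal{F}} (A\cap B).$$ Suppose that $Z$ is the vertex set of any connected component of $G\setminus X$. Then $|N(Z)|\leq |S|$.
   Context: Graphs are finite, simple and undirected. $N(Z)$ is the set of vertices outside $Z$ having a neighbour in $Z$. A separation of $G$ is a pair $(A,B)$ with $A\cup B=V(G)$ and no edge between $A\setminus B$ and $B\setminus A$; its order is $|A\cap B|$. For (not necessarily disjoint) $P,Q\subseteq V(G)$, a $P-Q$ separation is a separation $(A,B)$ with $P\subseteq A$ and $Q\subseteq B$. A separation $(A,B)$ is $S$-stable if there is a partition $(S_L,S_R)$ of $S$ (disjoint, possibly empty parts with union $S$) such that $(A,B)$ has minimum order among all $S_L-S_R$ separations of $G$. -}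

module Defs where

open import Data.Fin.Base using (Fin)
open import Data.Fin.Properties using (any?)
open import Data.Fin.Subset using (Subset; _∈_; _⊆_; _∪_; _∩_; _─_; ⊤; ⊥; Nonempty; ∣_∣)
open import Data.Fin.Subset.Properties using (_∈?_)
open import Data.Nat.Base using (ℕ; _≤_)
open import Data.Product.Base using (_×_; ∃₂)
open import Data.Vec.Base using (tabulate)
open import Level using (0ℓ)
open import Relation.Binary.Core using (Rel)
open import Relation.Binary.Definitions using (Decidable; Irreflexive; Symmetric)
open import Relation.Binary.Construct.Closure.ReflexiveTransitive using (Star)
open import Relation.Binary.PropositionalEquality.Core using (_≡_)
open import Relation.Nullary.Decidable.Core using (does; ¬?; _×-dec_)
open import Relation.Nullary.Negation.Core using (¬_)

-- Finite simple graphs with vertex set Fin n. Adjacency is required to be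
-- decidable, which classically is no restriction.
record Graph (n : ℕ) : Set₁ where
  field
    Adj    : Rel (Fin n) 0ℓ
    adj?   : Decidable Adj
    irrefl : Irreflexive _≡_ Adj
    symm   : Symmetric Adj

open Graph public

N : ∀ {n} → Graph n → Subset n → Subset n
N G Z = tabulate λ v →
  does (¬? (v ∈? Z) ×-dec any? (λ z → (z ∈? Z) ×-dec adj? G v z))

-- The adjacency relation of the induced subgraph G[W].
AdjIn : ∀ {n} → Graph n → Subset n → Rel (Fin n) 0ℓ
AdjIn G W u v = u ∈ W × v ∈ W × Adj G u v

-- G[W] is connected; the empty graph does not count as connected.
Connected : ∀ {n} → Graph n → Subset n → Set
Connected G W = Nonempty W × (∀ {u v} → u ∈ W → v ∈ W → Star (AdjIn G W) u v)

-- Z is the vertex set of a component (a maximal connected subgraph) of G[W].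
-- In particular, the components of G ∖ X are those of G[∁ X].
record IsComponent {n} (G : Graph n) (W Z : Subset n) : Set where
  field
    inside    : Z ⊆ W
    connected : Connected G Z
    maximal   : ∀ Z′ → Z ⊆ Z′ → Z′ ⊆ W → Connected G Z′ → Z′ ⊆ Z

record Separation {n} (G : Graph n) : Set where
  field
    A B    : Subset n
    cover  : A ∪ B ≡ ⊤
    noEdge : ∀ {u v} → u ∈ A ─ B → v ∈ B ─ A → ¬ Adj G u v

  separator : Subset n
  separator = A ∩ B

  order : ℕ
  order = ∣ separator ∣

open Separation public

Separates : ∀ {n} {G : Graph n} → Separation G → (P Q : Subset n) → Set
Separates s P Q = P ⊆ A s × Q ⊆ B s

IsPartition : ∀ {n} → (S L R : Subset n) → Set
IsPartition S L R = L ∪ R ≡ S × L ∩ R ≡ ⊥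

Stable : ∀ {n} {G : Graph n} → Subset n → Separation G → Set
Stable {G = G} S s = ∃₂ λ L R →
  IsPartition S L R ×
  Separates s L R ×
  (∀ (t : Separation G) → Separates t L R → order s ≤ order t)

{-# OPTIONS --safe #-}
-- Since the component Z is connected and avoids every separator, each
-- separation of the family can be oriented as (A , B) with Z ⊆ A ─ B. Starting
-- from (V , S), which has order ∣ S ∣, replace the current separation (P , Q)
-- by (P ∩ A , Q ∪ B) for each (A , B) in turn. The order never increases: as
-- S ⊆ Q, the opposite corner (P ∪ A , Q ∩ B) still separates the two parts of S
-- for which (A , B) is minimum, so submodularity applies. In the end S and all
-- separators lie in Q while Z ⊆ P ─ Q, whence N(Z) ⊆ P ∩ Q.
module Submission where

open import Defs
open import Data.Bool.Base using (true)
open import Data.Nat.Base using (ℕ; suc; _≤_; _+_)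
open import Data.Nat.Properties
  using (+-cancelʳ-≤; +-mono-≤; +-monoʳ-≤; +-suc; ≤-trans; module ≤-Reasoning)
open import Data.Fin.Base using (Fin)
open import Data.Fin.Properties using (any?)
open import Data.Fin.Subset
  using (Subset; inside; outside; _∈_; _∉_; _⊆_; _∪_; _∩_; _─_; ⋃; ∁; ⁅_⁆; ⊤; ∣_∣)
open import Data.Fin.Subset.Properties
open import Data.List.Base using (List; []; _∷_; map)
open import Data.List.Relation.Unary.All using (All; []; _∷_)
open import Data.Product.Base using (∃-syntax; _×_; _,_)
open import Data.Sum.Base using (_⊎_; inj₁; inj₂; [_,_]′)
import Data.Sum.Base as Sum
open import Data.Vec.Base using ([]; _∷_; here; there)
open import Data.Vec.Properties using (lookup∘tabulate; []=⇒lookup)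
open import Function.Base using (_∘_; id)
open import Relation.Binary.Construct.Closure.ReflexiveTransitive
  using (Star; ε; _◅_; _◅◅_)
import Relation.Binary.Construct.Closure.ReflexiveTransitive as Star
open import Relation.Binary.PropositionalEquality
  using (_≡_; refl; sym; trans; cong; subst; subst₂)
open import Relation.Nullary.Decidable using (Dec; yes; no; does; ¬?; _×-dec_)
open import Relation.Nullary.Negation using (¬_; contradiction)

private
  variable
    n : ℕ
    G : Graph n
    S Z : Subset n

-- Finite subsets and neighbourhoods.

∣p∪q∣+∣p∩q∣≡∣p∣+∣q∣ : (p q : Subset n) → ∣ p ∪ q ∣ + ∣ p ∩ q ∣ ≡ ∣ p ∣ + ∣ q ∣
∣p∪q∣+∣p∩q∣≡∣p∣+∣q∣ []            []            = refl
∣p∪q∣+∣p∩q∣≡∣p∣+∣q∣ (outside ∷ p) (outside ∷ q) = ∣p∪q∣+∣p∩q∣≡∣p∣+∣q∣ p q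
∣p∪q∣+∣p∩q∣≡∣p∣+∣q∣ (inside ∷ p)  (outside ∷ q) = cong suc (∣p∪q∣+∣p∩q∣≡∣p∣+∣q∣ p q)
∣p∪q∣+∣p∩q∣≡∣p∣+∣q∣ (outside ∷ p) (inside ∷ q)
  rewrite +-suc ∣ p ∣ ∣ q ∣ = cong suc (∣p∪q∣+∣p∩q∣≡∣p∣+∣q∣ p q)
∣p∪q∣+∣p∩q∣≡∣p∣+∣q∣ (inside ∷ p)  (inside ∷ q)
  rewrite +-suc ∣ p ∪ q ∣ ∣ p ∩ q ∣ | +-suc ∣ p ∣ ∣ q ∣
  = cong (suc ∘ suc) (∣p∪q∣+∣p∩q∣≡∣p∣+∣q∣ p q)

x∈p─q⇒x∉q : ∀ {x} (p q : Subset n) → x ∈ p ─ q → x ∉ q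
x∈p─q⇒x∉q (inside ∷ p) (outside ∷ q) here        ()
x∈p─q⇒x∉q (_ ∷ p)      (inside ∷ q)  (there x∈d) (there x∈q) = x∈p─q⇒x∉q p q x∈d x∈q
x∈p─q⇒x∉q (_ ∷ p)      (outside ∷ q) (there x∈d) (there x∈q) = x∈p─q⇒x∉q p q x∈d x∈q

does-true : ∀ {P : Set} (P? : Dec P) → does P? ≡ true → P
does-true (yes p) _ = p

∈N⇒neighbour : (G : Graph n) (Z : Subset n) {v : Fin n} → v ∈ N G Z →
               v ∉ Z × (∃[ z ] z ∈ Z × Adj G v z)
-- `N` is tabulated from a boolean test, so reading entry `v` returns the decision, and its truth
-- gives back the proposition decided.
∈N⇒neighbour G Z {v} v∈N =
  does-true (¬? (v ∈? Z) ×-dec any? (λ z → (z ∈? Z) ×-dec adj? G v z))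
    (trans (sym (lookup∘tabulate _ v)) ([]=⇒lookup v∈N))

infix 4 _Avoids_
_Avoids_ : Subset n → Subset n → Set
Z Avoids Y = ∀ {v} → v ∈ Z → v ∉ Y

-- Separations, corners and submodularity.

covers : (s : Separation G) (v : Fin n) → v ∈ A s ⊎ v ∈ B s
covers s v = x∈p∪q⁻ (A s) (B s) (subst (v ∈_) (sym (cover s)) ∈⊤)

∉A⇒∈B : (s : Separation G) {v : Fin n} → v ∉ A s → v ∈ B s
∉A⇒∈B s {v} v∉A = [ (λ v∈A → contradiction v∈A v∉A) , id ]′ (covers s v)

noEdge′ : (s : Separation G) {u v : Fin n} → u ∈ A s → u ∉ B s → v ∉ A s → ¬ Adj G u v
noEdge′ s u∈A u∉B v∉A =
  noEdge s (x∈p∧x∉q⇒x∈p─q u∈A u∉B) (x∈p∧x∉q⇒x∈p─q (∉A⇒∈B s v∉A) v∉A)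

-- The edge condition omits `v ∈ Q`, which `v ∉ P` forces by the cover.
separation : (P Q : Subset n) → (∀ v → v ∈ P ⊎ v ∈ Q) →
             (∀ {u v} → u ∈ P → u ∉ Q → v ∉ P → ¬ Adj G u v) → Separation G
separation P Q cov noE = record
  { A      = P
  ; B      = Q
  ; cover  = ⊆-antisym ⊆⊤ (λ {v} _ → x∈p∪q⁺ (cov v))
  ; noEdge = λ u∈ v∈ → noE (p─q⊆p P Q u∈) (x∈p─q⇒x∉q P Q u∈) (x∈p─q⇒x∉q Q P v∈)
  }

swap : Separation G → Separation G
swap {G = G} s = record
  { A      = B s
  ; B      = A s
  ; cover  = trans (∪-comm (B s) (A s)) (cover s)
  ; noEdge = λ u∈ v∈ uv → noEdge s v∈ u∈ (symm G uv)
  }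

order-swap : (s : Separation G) → order (swap s) ≡ order s
order-swap s = cong ∣_∣ (∩-comm (B s) (A s))

-- The two parts of `S` trade places, and each competitor `t` is compared through its own swap,
-- which has the same order.
swap-stable : (s : Separation G) → Stable S s → Stable S (swap s)
swap-stable s (L , R , (L∪R≡S , L∩R≡⊥) , (L⊆A , R⊆B) , minimal) =
  R , L , (trans (∪-comm R L) L∪R≡S , trans (∩-comm R L) L∩R≡⊥) , (R⊆B , L⊆A) ,
  λ t (R⊆At , L⊆Bt) →
    subst₂ _≤_ (sym (order-swap s)) (order-swap t) (minimal (swap t) (L⊆Bt , R⊆At))

corner : (s t : Separation G) → Separation G
corner {G = G} s t = separation (A s ∩ A t) (B s ∪ B t) cov noE
  where
  cov : ∀ v → v ∈ A s ∩ A t ⊎ v ∈ B s ∪ B t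
  cov v with covers s v | covers t v
  ... | inj₂ v∈Bs | _         = inj₂ (x∈p∪q⁺ (inj₁ v∈Bs))
  ... | inj₁ _    | inj₂ v∈Bt = inj₂ (x∈p∪q⁺ (inj₂ v∈Bt))
  ... | inj₁ v∈As | inj₁ v∈At = inj₁ (x∈p∩q⁺ (v∈As , v∈At))

  noE : ∀ {u v} → u ∈ A s ∩ A t → u ∉ B s ∪ B t → v ∉ A s ∩ A t → ¬ Adj G u v
  -- Leaving `A s ∩ A t` means leaving `A s` or `A t`. Since `u` is in neither second side, the edge
  -- would cross `s` or `t` accordingly.
  noE {v = v} u∈ u∉ v∉ with x∈p∩q⁻ (A s) (A t) u∈ | v ∈? A s
  ... | u∈As , _ | no v∉As  = noEdge′ s u∈As (u∉ ∘ x∈p∪q⁺ ∘ inj₁) v∉As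
  ... | _ , u∈At | yes v∈As =
    noEdge′ t u∈At (u∉ ∘ x∈p∪q⁺ ∘ inj₂) (λ v∈At → v∉ (x∈p∩q⁺ (v∈As , v∈At)))

-- Swapping back restores the order of the sides: this is `(A s ∪ A t , B s ∩ B t)`.
oppositeCorner : (s t : Separation G) → Separation G
oppositeCorner s t = swap (corner (swap s) (swap t))

-- A vertex of either corner separator lies in both sides of `s` or both sides of `t`, and a vertex
-- of both corner separators lies in all four sides. Counting unions and intersections then gives
-- the inequality.
order-submodular : (s t : Separation G) →
  order (corner s t) + order (oppositeCorner s t) ≤ order s + order t
order-submodular s t = begin
  ∣ I ∣ + ∣ U ∣          ≡⟨ ∣p∪q∣+∣p∩q∣≡∣p∣+∣q∣ I U ⟨
  ∣ I ∪ U ∣ + ∣ I ∩ U ∣  ≤⟨ +-mono-≤ (p⊆q⇒∣p∣≤∣q∣ ∪⊆) (p⊆q⇒∣p∣≤∣q∣ ∩⊆) ⟩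
  ∣ X ∪ Y ∣ + ∣ X ∩ Y ∣  ≡⟨ ∣p∪q∣+∣p∩q∣≡∣p∣+∣q∣ X Y ⟩
  ∣ X ∣ + ∣ Y ∣          ∎
  where
  open ≤-Reasoning
  I = separator (corner s t)
  U = separator (oppositeCorner s t)
  X = separator s
  Y = separator t

  I⁻ : ∀ {v} → v ∈ I → (v ∈ A s × v ∈ A t) × (v ∈ B s ⊎ v ∈ B t)
  I⁻ v∈I with x∈p∩q⁻ (A s ∩ A t) (B s ∪ B t) v∈I
  ... | v∈A , v∈B = x∈p∩q⁻ (A s) (A t) v∈A , x∈p∪q⁻ (B s) (B t) v∈B

  U⁻ : ∀ {v} → v ∈ U → (v ∈ A s ⊎ v ∈ A t) × (v ∈ B s × v ∈ B t)
  U⁻ v∈U with x∈p∩q⁻ (A s ∪ A t) (B s ∩ B t) v∈U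
  ... | v∈A , v∈B = x∈p∪q⁻ (A s) (A t) v∈A , x∈p∩q⁻ (B s) (B t) v∈B

  I⊆ : I ⊆ X ∪ Y
  I⊆ v∈I with I⁻ v∈I
  ... | (v∈As , v∈At) , v∈B =
    x∈p∪q⁺ (Sum.map (λ v∈Bs → x∈p∩q⁺ (v∈As , v∈Bs)) (λ v∈Bt → x∈p∩q⁺ (v∈At , v∈Bt)) v∈B)

  U⊆ : U ⊆ X ∪ Y
  U⊆ v∈U with U⁻ v∈U
  ... | v∈A , (v∈Bs , v∈Bt) =
    x∈p∪q⁺ (Sum.map (λ v∈As → x∈p∩q⁺ (v∈As , v∈Bs)) (λ v∈At → x∈p∩q⁺ (v∈At , v∈Bt)) v∈A)

  ∪⊆ : I ∪ U ⊆ X ∪ Y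
  ∪⊆ = [ I⊆ , U⊆ ]′ ∘ x∈p∪q⁻ I U

  ∩⊆ : I ∩ U ⊆ X ∩ Y
  ∩⊆ v∈I∩U with x∈p∩q⁻ I U v∈I∩U
  ... | v∈I , v∈U with I⁻ v∈I | U⁻ v∈U
  ... | (v∈As , v∈At) , _ | _ , (v∈Bs , v∈Bt) =
    x∈p∩q⁺ (x∈p∩q⁺ (v∈As , v∈Bs) , x∈p∩q⁺ (v∈At , v∈Bt))

-- The opposite corner is a competitor of `t`, so `order t` is at most its order; cancelling
-- `order t` in the submodular inequality leaves the bound.
order-corner-stable : (s t : Separation G) → Stable S t → S ⊆ B s →
                      order (corner s t) ≤ order s
order-corner-stable s t (L , R , (refl , _) , (L⊆At , R⊆Bt) , minimal) S⊆Bs =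
  +-cancelʳ-≤ (order t) (order (corner s t)) (order s)
    (≤-trans (+-monoʳ-≤ (order (corner s t)) (minimal (oppositeCorner s t) separates))
             (order-submodular s t))
  where
  separates : Separates (oppositeCorner s t) L R
  -- `S` has become `L ∪ R`, so `S ⊆ B s` puts `R` into the smaller side `B s ∩ B t`.
  separates = (λ v∈L → x∈p∪q⁺ (inj₂ (L⊆At v∈L))) ,
              (λ v∈R → x∈p∩q⁺ (S⊆Bs (x∈p∪q⁺ (inj₂ v∈R)) , R⊆Bt v∈R))

-- Isolating a connected set.

_Within_ : Subset n → Separation {n} G → Set
Z Within s = Z ⊆ A s × Z Avoids B s

-- A walk inside `Z` never meets the separator, so changing sides would need an edge between
-- `A s ─ B s` and `B s ─ A s`. The side of one vertex `z` thus decides for all of `Z`.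
connected-within : Connected G Z → (s : Separation G) → Z Avoids separator s →
                   Z Within s ⊎ Z Within (swap s)
connected-within {G = G} {Z = Z} ((z , z∈Z) , path) s avoids with z ∈? A s
... | yes z∈A = inj₁ ((λ v∈Z → walk z∈A (path z∈Z v∈Z)) ,
                      (λ v∈Z v∈B → avoids v∈Z (x∈p∩q⁺ (walk z∈A (path z∈Z v∈Z) , v∈B))))
  where
  walk : ∀ {u v} → u ∈ A s → Star (AdjIn G Z) u v → v ∈ A s
  walk u∈A ε = u∈A
  walk {u} u∈A (_◅_ {j = w} (u∈Z , w∈Z , uw) ws) with w ∈? A s
  ... | yes w∈A = walk w∈A ws
  ... | no w∉A  =
    contradiction uw (noEdge′ s u∈A (λ u∈B → avoids u∈Z (x∈p∩q⁺ (u∈A , u∈B))) w∉A)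
... | no z∉A = inj₂ ((λ v∈Z → ∉A⇒∈B s (walk z∉A (path z∈Z v∈Z))) ,
                     (λ v∈Z → walk z∉A (path z∈Z v∈Z)))
  where
  walk : ∀ {u v} → u ∉ A s → Star (AdjIn G Z) u v → v ∉ A s
  walk u∉A ε = u∉A
  walk u∉A ((u∈Z , w∈Z , uw) ◅ ws) = walk
    (λ w∈A → noEdge′ s w∈A (λ w∈B → avoids w∈Z (x∈p∩q⁺ (w∈A , w∈B))) u∉A (symm G uw)) ws

-- The separator lies in both sides of `s`, hence in the second side under either orientation.
orient : Connected G Z → (s : Separation G) → Stable S s → Z Avoids separator s →
         ∃[ t ] Stable S t × Z Within t × separator s ⊆ B t
orient conn s stable avoids with connected-within conn s avoids
... | inj₁ within = s , stable , within , p∩q⊆q (A s) (B s)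
... | inj₂ within = swap s , swap-stable s stable , within , p∩q⊆p (A s) (B s)

isolating-separation : (F : List (Separation G)) → All (Stable S) F → Connected G Z →
  Z Avoids (S ∪ ⋃ (map separator F)) →
  ∃[ t ] Z Within t × S ∪ ⋃ (map separator F) ⊆ B t × order {G = G} t ≤ ∣ S ∣
isolating-separation {S = S} [] [] conn avoids =
  -- Nothing lies outside `⊤`, so the edge condition is vacuous.
  separation ⊤ S (λ _ → inj₁ ∈⊤) (λ _ _ v∉⊤ → contradiction ∈⊤ v∉⊤) ,
  (⊆⊤ , λ v∈Z v∈S → avoids v∈Z (x∈p∪q⁺ (inj₁ v∈S))) ,
  (λ v∈ → [ id , (λ v∈⊥ → contradiction v∈⊥ ∉⊥) ]′ (x∈p∪q⁻ S _ v∈)) ,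
  ∣p∩q∣≤∣q∣ ⊤ S
isolating-separation {S = S} {Z = Z} (s ∷ F) (stable ∷ stables) conn avoids
  with isolating-separation F stables conn
         (λ v∈Z → avoids v∈Z ∘ x∈p∪q⁺ ∘ Sum.map₂ (x∈p∪q⁺ ∘ inj₂) ∘ x∈p∪q⁻ S _)
     | orient conn s stable (λ v∈Z → avoids v∈Z ∘ x∈p∪q⁺ ∘ inj₂ ∘ x∈p∪q⁺ ∘ inj₁)
... | t , (Z⊆At , Z∥Bt) , X⊆Bt , t≤S | s′ , stable′ , (Z⊆As , Z∥Bs) , sep⊆Bs =
  corner t s′ ,
  ( (λ v∈Z → x∈p∩q⁺ (Z⊆At v∈Z , Z⊆As v∈Z))
  , (λ v∈Z → [ Z∥Bt v∈Z , Z∥Bs v∈Z ]′ ∘ x∈p∪q⁻ (B t) (B s′))) ,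
  [ inB-t ∘ inj₁ , [ x∈p∪q⁺ ∘ inj₂ ∘ sep⊆Bs , inB-t ∘ inj₂ ]′ ∘ x∈p∪q⁻ (separator s) _ ]′
    ∘ x∈p∪q⁻ S _ ,
  -- The invariant that `B t` contains `S` is what allows the stable separation to be applied here.
  ≤-trans (order-corner-stable t s′ stable′ (X⊆Bt ∘ x∈p∪q⁺ ∘ inj₁)) t≤S
  where
  inB-t : ∀ {v} → v ∈ S ⊎ v ∈ ⋃ (map separator F) → v ∈ B t ∪ B s′
  inB-t = x∈p∪q⁺ ∘ inj₁ ∘ X⊆Bt ∘ x∈p∪q⁺

-- Neighbours of a component.

connected-insert : Connected G Z → ∀ {v z} → z ∈ Z → Adj G v z → Connected G (Z ∪ ⁅ v ⁆)
connected-insert {G = G} {Z = Z} ((y , y∈Z) , path) {v} {z} z∈Z vz =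
  -- All walks are routed through `z`, which the new vertex reaches by its edge.
  (y , old y∈Z) , λ a∈ b∈ → toZ a∈ ◅◅ fromZ b∈
  where
  Z⁺ = Z ∪ ⁅ v ⁆

  old : Z ⊆ Z⁺
  old = x∈p∪q⁺ ∘ inj₁

  v∈Z⁺ : v ∈ Z⁺
  v∈Z⁺ = x∈p∪q⁺ (inj₂ (x∈⁅x⁆ v))

  lift : ∀ {a b} → Star (AdjIn G Z) a b → Star (AdjIn G Z⁺) a b
  lift = Star.map λ (a∈ , b∈ , ab) → old a∈ , old b∈ , ab

  toZ : ∀ {a} → a ∈ Z⁺ → Star (AdjIn G Z⁺) a z
  toZ a∈ with x∈p∪q⁻ Z ⁅ v ⁆ a∈
  ... | inj₁ a∈Z = lift (path a∈Z z∈Z)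
  ... | inj₂ a∈v with refl ← x∈⁅y⁆⇒x≡y v a∈v = (v∈Z⁺ , old z∈Z , vz) ◅ ε

  fromZ : ∀ {a} → a ∈ Z⁺ → Star (AdjIn G Z⁺) z a
  fromZ = Star.reverse (λ (a∈ , b∈ , ab) → b∈ , a∈ , symm G ab) ∘ toZ

-- A neighbour outside `X` could be added to `Z`, against maximality.
N-component⊆ : (G : Graph n) {X Z : Subset n} → IsComponent G (∁ X) Z → N G Z ⊆ X
N-component⊆ G {X} {Z} comp {v} v∈N with v ∈? X | ∈N⇒neighbour G Z v∈N
... | yes v∈X | _ = v∈X
... | no v∉X  | v∉Z , z , z∈Z , vz = contradiction
  (maximal (Z ∪ ⁅ v ⁆) (x∈p∪q⁺ ∘ inj₁)
    ([ inside′ , (λ a∈v → subst (_∈ ∁ X) (sym (x∈⁅y⁆⇒x≡y v a∈v)) (x∉p⇒x∈∁p v∉X)) ]′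
       ∘ x∈p∪q⁻ Z ⁅ v ⁆)
    (connected-insert {G = G} connected z∈Z vz)
    (x∈p∪q⁺ (inj₂ (x∈⁅x⁆ v))))
  v∉Z
  where open IsComponent comp renaming (inside to inside′)

-- A neighbour outside `A s` would be joined to `A s ─ B s`, which contains `Z`.
N-within⊆A : (s : Separation G) → Z Within s → N G Z ⊆ A s
N-within⊆A {G = G} {Z = Z} s (Z⊆A , Z∥B) {v} v∈N with v ∈? A s | ∈N⇒neighbour G Z v∈N
... | yes v∈A | _ = v∈A
... | no v∉A  | _ , z , z∈Z , vz =
  contradiction (symm G vz) (noEdge′ s (Z⊆A z∈Z) (Z∥B z∈Z) v∉A)

lemma3p2 : (n : ℕ) (G : Graph n) (S : Subset n) (F : List (Separation G)) →
    All (Stable S) F →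
    (Z : Subset n) →
    IsComponent G (∁ (S ∪ ⋃ (map separator F))) Z →
    ∣ N G Z ∣ ≤ ∣ S ∣
lemma3p2 n G S F stable Z comp
  with isolating-separation F stable (IsComponent.connected comp)
         (x∈∁p⇒x∉p ∘ IsComponent.inside comp)
... | t , within , X⊆B , t≤S = ≤-trans
  (p⊆q⇒∣p∣≤∣q∣ λ v∈N →
    x∈p∩q⁺ (N-within⊆A t within v∈N , X⊆B (N-component⊆ G comp v∈N)))
  t≤S
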